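{- Let documents $t_1,\ldots,t_N$, each containing at most $L$ distinct words from a dictionary of $D\ge 2$ words, arrive one at a time in a stream. Fix $\epsilon\in(0,1]$ and $p=2\log D$. The streaming algorithm maintains, for each word $x$, a counter $\#(x)$ of the number of documents seen so far containing $x$, and a hash map $H$ keyed by pairs of words, each entry holding a bag of numbers. On arrival of a document, the counters are updated, and for each unordered pair of distinct words $x,y$ in the document, with an independent coin flip of probability $q=\min\!\left(1,\frac{p}{\epsilon}\frac{1}{\sqrt{\#(x)\#(y)}}\right)$ (computed with the current counter values), the value $q$ is inserted into the bag of $(x,y)$ in $H$. Then the expected total memory used by this algorithm (the size of $H$ together with the counters) is $O(DL\lg(N)\log(D)/\epsilon)$.
   Context: $\lg$ is the base-2 logarithm and $\log$ the natural logarithm. Queries for the similarity of $x,y$ are answered by independently subsampling each stored value $q_i$ in the bag of $(x,y)$ with probability $\frac{p}{\epsilon}\frac{1}{q_i\sqrt{\#(x)\#(y)}}$ and scaling the number of survivors by $\epsilon/p$; queries do not affect memory. -}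

module Defs where

open import Data.Bool using (Bool; true; false; if_then_else_)
open import Data.Fin using (Fin; _<?_)
open import Data.Fin.Properties using () renaming (_≟_ to _≟ᶠ_)
open import Data.Fin.Subset using (Subset)
open import Data.Fin.Subset.Properties using (_∈?_)
open import Data.Integer using (+_)
import Data.Integer as ℤ
import Data.Integer.Properties as ℤ
open import Data.List using (List; []; _∷_; length; sum; map; filter; allFin; cartesianProduct)
open import Data.Nat using (ℕ; zero; suc; pred)
import Data.Nat as ℕ
import Data.Nat.Properties as ℕ
import Data.Nat.Solver as ℕ-Solver
open import Data.Product using (∃-syntax; _×_; _,_)
open import Data.Product.Properties using (≡-dec)
open import Data.Rational using (ℚ; 0ℚ; 1ℚ; ½; _/_; _+_; _*_; _-_; -_; 1/_; ∣_∣; _⊓_; _≤_; _<_; *≤*; *<*)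
import Data.Rational as ℚ
import Data.Rational.Properties as ℚ
open import Data.Rational.Solver using (module +-*-Solver)
import Data.Rational.Unnormalised as ℚᵘ
import Data.Rational.Unnormalised.Properties as ℚᵘ
open import Data.Sum using (inj₁; inj₂)
open import Data.Vec using (Vec; []; _∷_; lookup; zipWith; replicate)
open import Relation.Binary.PropositionalEquality using (_≡_; refl; sym; trans; cong; cong₂; subst; subst₂; module ≡-Reasoning)
open import Relation.Nullary using (yes; no; contradiction; _×-dec_)

-- A real is a Cauchy sequence of rationals together with a modulus of
-- convergence (the witness N below).  Two reals denote the same number
-- when each is ≤ᴿ the other.

IsCauchy : (ℕ → ℚ) → Set
IsCauchy s = ∀ δ → 0ℚ < δ → ∃[ N ] ∀ m n → N ℕ.≤ m → N ℕ.≤ n → ∣ s m - s n ∣ ≤ δ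

record ℝ : Set where
  constructor mkℝ
  field
    seq    : ℕ → ℚ
    cauchy : IsCauchy seq

open ℝ public

infix 4 _≤ᴿ_ _<ᴿ_

_≤ᴿ_ : ℝ → ℝ → Set
x ≤ᴿ y = ∀ δ → 0ℚ < δ → ∃[ N ] ∀ n → N ℕ.≤ n → seq x n ≤ seq y n + δ

_<ᴿ_ : ℝ → ℝ → Set
x <ᴿ y = ∃[ δ ] 0ℚ < δ × ∃[ N ] ∀ n → N ℕ.≤ n → seq x n + δ ≤ seq y n

near⇒≤ : ∀ p q {δ} → ∣ p - q ∣ ≤ δ → p ≤ q + δ
near⇒≤ p q {δ} h = subst (_≤ q + δ) (solve 2 (λ p q → q :+ (p :- q) := p) refl p q)
  (ℚ.+-monoʳ-≤ q (ℚ.≤-trans (p≤∣p∣ (p - q)) h))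
  where
  open +-*-Solver
  p≤∣p∣ : ∀ r → r ≤ ∣ r ∣
  p≤∣p∣ r with ℚ.≤-total 0ℚ r
  ... | inj₁ 0≤r = ℚ.≤-reflexive (sym (ℚ.0≤p⇒∣p∣≡p 0≤r))
  ... | inj₂ r≤0 = ℚ.≤-trans r≤0 (ℚ.0≤∣p∣ r)

≤⇒near : ∀ p q {δ} → p ≤ q + δ → q ≤ p + δ → ∣ p - q ∣ ≤ δ
≤⇒near p q {δ} h h′ with ℚ.∣p∣≡p∨∣p∣≡-p (p - q)
... | inj₁ e = subst₂ _≤_ (sym e) (solve 2 (λ q d → (q :+ d) :- q := d) refl q δ) (ℚ.+-monoˡ-≤ (- q) h)
  where
  open +-*-Solver
... | inj₂ e = subst₂ _≤_ (trans (solve 2 (λ p q → q :- p := :- (p :- q)) refl p q) (sym e))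
                 (solve 2 (λ p d → (p :+ d) :- p := d) refl p δ) (ℚ.+-monoˡ-≤ (- p) h′)
  where
  open +-*-Solver

cauchy-from-≤ : ∀ {s} → (∀ δ → 0ℚ < δ → ∃[ N ] ∀ m n → N ℕ.≤ m → N ℕ.≤ n → s m ≤ s n + δ) → IsCauchy s
cauchy-from-≤ {s} h δ 0<δ with h δ 0<δ
... | N , f = N , λ m n N≤m N≤n → ≤⇒near (s m) (s n) (f m n N≤m N≤n) (f n m N≤n N≤m)

half : ∀ δ → δ * ½ + δ * ½ ≡ δ
half δ = solve 1 (λ d → d :* con ½ :+ d :* con ½ := d) refl δ
  where
  open +-*-Solver

*-pos : ∀ {p q} → 0ℚ < p → 0ℚ < q → 0ℚ < p * q
*-pos {p} {q} 0<p 0<q = ℚ.positive⁻¹ (p * q) {{ℚ.pos*pos⇒pos p {{ℚ.positive 0<p}} q {{ℚ.positive 0<q}}}}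

0<½ : 0ℚ < ½
0<½ = ℚ.positive⁻¹ ½

half-pos : ∀ {δ} → 0ℚ < δ → 0ℚ < δ * ½
half-pos 0<δ = *-pos 0<δ 0<½

*-mono : ∀ {p q r s} → 0ℚ ≤ p → 0ℚ ≤ s → p ≤ q → r ≤ s → p * r ≤ q * s
*-mono {p} {q} {r} {s} 0≤p 0≤s p≤q r≤s = ℚ.≤-trans
  (ℚ.*-monoˡ-≤-nonNeg p {{ℚ.nonNegative 0≤p}} r≤s)
  (ℚ.*-monoʳ-≤-nonNeg s {{ℚ.nonNegative 0≤s}} p≤q)

fromℚ : ℚ → ℝ
fromℚ q = mkℝ (λ _ → q) (cauchy-from-≤ λ δ 0<δ → 0 , λ _ _ _ _ →
  ℚ.≤-trans (ℚ.≤-reflexive (sym (ℚ.+-identityʳ q))) (ℚ.+-monoʳ-≤ q (ℚ.<⇒≤ 0<δ)))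

fromℕ : ℕ → ℝ
fromℕ n = fromℚ (+ n / 1)

0ᴿ 1ᴿ : ℝ
0ᴿ = fromℕ 0
1ᴿ = fromℕ 1

infixl 6 _+ᴿ_ _-ᴿ_
infixl 7 _*ᴿ_ _⊓ᴿ_
infix  8 -ᴿ_

_+ᴿ_ : ℝ → ℝ → ℝ
seq    (x +ᴿ y) n = seq x n + seq y n
cauchy (x +ᴿ y) = cauchy-from-≤ λ δ 0<δ →
  let N₁ , f = cauchy x (δ * ½) (half-pos 0<δ)
      N₂ , g = cauchy y (δ * ½) (half-pos 0<δ)
  in N₁ ℕ.⊔ N₂ , λ m n N≤m N≤n → subst (seq x m + seq y m ≤_)
       (trans (solve 4 (λ a b d e → (a :+ d) :+ (b :+ e) := (a :+ b) :+ (d :+ e)) refl (seq x n) (seq y n) (δ * ½) (δ * ½))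
              (cong (λ e → seq x n + seq y n + e) (half δ)))
       (ℚ.+-mono-≤ (near⇒≤ (seq x m) (seq x n) (f m n (ℕ.m⊔n≤o⇒m≤o N₁ N₂ N≤m) (ℕ.m⊔n≤o⇒m≤o N₁ N₂ N≤n)))
                   (near⇒≤ (seq y m) (seq y n) (g m n (ℕ.m⊔n≤o⇒n≤o N₁ N₂ N≤m) (ℕ.m⊔n≤o⇒n≤o N₁ N₂ N≤n))))
  where
  open +-*-Solver

-ᴿ_ : ℝ → ℝ
seq    (-ᴿ x) n = - seq x n
cauchy (-ᴿ x) = cauchy-from-≤ λ δ 0<δ →
  let N , f = cauchy x δ 0<δ
  in N , λ m n N≤m N≤n → subst₂ _≤_
       (solve 2 (λ a b → b :+ (:- a :- b) := :- a) refl (seq x m) (seq x n))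
       (solve 3 (λ a b d → (a :+ d) :+ (:- a :- b) := :- b :+ d) refl (seq x m) (seq x n) δ)
       (ℚ.+-monoˡ-≤ (- seq x m - seq x n) (near⇒≤ (seq x n) (seq x m) (f n m N≤n N≤m)))
  where
  open +-*-Solver

_-ᴿ_ : ℝ → ℝ → ℝ
x -ᴿ y = x +ᴿ (-ᴿ y)

_⊓ᴿ_ : ℝ → ℝ → ℝ
seq    (x ⊓ᴿ y) n = seq x n ⊓ seq y n
cauchy (x ⊓ᴿ y) = cauchy-from-≤ λ δ 0<δ →
  let N₁ , f = cauchy x δ 0<δ
      N₂ , g = cauchy y δ 0<δ
  in N₁ ℕ.⊔ N₂ , λ m n N≤m N≤n → subst (seq x m ⊓ seq y m ≤_)
       (sym (ℚ.mono-≤-distrib-⊓ (ℚ.+-monoˡ-≤ δ) (seq x n) (seq y n)))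
       (ℚ.⊓-mono-≤ (near⇒≤ (seq x m) (seq x n) (f m n (ℕ.m⊔n≤o⇒m≤o N₁ N₂ N≤m) (ℕ.m⊔n≤o⇒m≤o N₁ N₂ N≤n)))
                   (near⇒≤ (seq y m) (seq y n) (g m n (ℕ.m⊔n≤o⇒n≤o N₁ N₂ N≤m) (ℕ.m⊔n≤o⇒n≤o N₁ N₂ N≤n))))

-- 0 at 0; only its values at positive rationals matter.
inv : ℚ → ℚ
inv q with q ℚ.≟ 0ℚ
... | yes _  = 0ℚ
... | no q≢0 = (1/ q) {{ℚ.≢-nonZero q≢0}}

inv-* : ∀ {q} → 0ℚ < q → inv q * q ≡ 1ℚ
inv-* {q} 0<q with q ℚ.≟ 0ℚ
... | yes q≡0 = contradiction (sym q≡0) (ℚ.<⇒≢ 0<q)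
... | no q≢0  = ℚ.*-inverseˡ q {{ℚ.≢-nonZero q≢0}}

inv-pos : ∀ {q} → 0ℚ < q → 0ℚ < inv q
inv-pos {q} 0<q with q ℚ.≟ 0ℚ
... | yes q≡0 = contradiction (sym q≡0) (ℚ.<⇒≢ 0<q)
... | no q≢0  = ℚ.positive⁻¹ _ {{ℚ.1/pos⇒pos q {{ℚ.positive 0<q}}}}

bounded : ∀ x → ∃[ B ] 0ℚ < B × ∃[ N ] ∀ n → N ℕ.≤ n → ∣ seq x n ∣ ≤ B
bounded x with cauchy x 1ℚ (ℚ.positive⁻¹ 1ℚ)
... | N , f = 1ℚ + ∣ seq x N ∣ , ℚ.+-mono-<-≤ (ℚ.positive⁻¹ 1ℚ) (ℚ.0≤∣p∣ (seq x N)) , N , λ n N≤n →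
  subst (λ a → ∣ a ∣ ≤ 1ℚ + ∣ seq x N ∣)
    (solve 2 (λ a b → (a :- b) :+ b := a) refl (seq x n) (seq x N))
    (ℚ.≤-trans (ℚ.∣p+q∣≤∣p∣+∣q∣ (seq x n - seq x N) (seq x N))
               (ℚ.+-monoˡ-≤ ∣ seq x N ∣ (f n N N≤n ℕ.≤-refl)))
  where
  open +-*-Solver

*-near : ∀ a b c d {A B δ} → 0ℚ < A → 0ℚ < B → ∣ a ∣ ≤ A → ∣ d ∣ ≤ B → 0ℚ < δ →
         ∣ a - c ∣ ≤ δ * ½ * inv B → ∣ b - d ∣ ≤ δ * ½ * inv A → ∣ a * b - c * d ∣ ≤ δ
*-near a b c d {A} {B} {δ} 0<A 0<B a≤A d≤B 0<δ ac bd = begin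
  ∣ a * b - c * d ∣                           ≡⟨ cong ∣_∣ (solve 4 (λ a b c d → a :* b :- c :* d := a :* (b :- d) :+ (a :- c) :* d) refl a b c d) ⟩
  ∣ a * (b - d) + (a - c) * d ∣               ≤⟨ ℚ.∣p+q∣≤∣p∣+∣q∣ (a * (b - d)) ((a - c) * d) ⟩
  ∣ a * (b - d) ∣ + ∣ (a - c) * d ∣           ≡⟨ cong₂ _+_ (ℚ.∣p*q∣≡∣p∣*∣q∣ a (b - d)) (ℚ.∣p*q∣≡∣p∣*∣q∣ (a - c) d) ⟩
  ∣ a ∣ * ∣ b - d ∣ + ∣ a - c ∣ * ∣ d ∣       ≤⟨ ℚ.+-mono-≤
                                                  (*-mono (ℚ.0≤∣p∣ a) (ℚ.<⇒≤ (*-pos (half-pos 0<δ) (inv-pos 0<A))) a≤A bd)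
                                                  (*-mono (ℚ.0≤∣p∣ (a - c)) (ℚ.<⇒≤ 0<B) ac d≤B) ⟩
  A * (δ * ½ * inv A) + δ * ½ * inv B * B     ≡⟨ solve 5 (λ A B e i j → A :* (e :* i) :+ e :* j :* B := e :* (i :* A) :+ e :* (j :* B))
                                                   refl A B (δ * ½) (inv A) (inv B) ⟩
  δ * ½ * (inv A * A) + δ * ½ * (inv B * B)   ≡⟨ cong₂ (λ u v → δ * ½ * u + δ * ½ * v) (inv-* 0<A) (inv-* 0<B) ⟩
  δ * ½ * 1ℚ + δ * ½ * 1ℚ                     ≡⟨ cong₂ _+_ (ℚ.*-identityʳ (δ * ½)) (ℚ.*-identityʳ (δ * ½)) ⟩
  δ * ½ + δ * ½                               ≡⟨ half δ ⟩
  δ                                           ∎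
  where
  open +-*-Solver
  open ℚ.≤-Reasoning

inv-near : ∀ {a b c δ} → 0ℚ < c → c ≤ a → c ≤ b → 0ℚ < δ → b ≤ a + δ * (c * c) → inv a ≤ inv b + δ
inv-near {a} {b} {c} {δ} 0<c c≤a c≤b 0<δ h =
  ℚ.*-cancelʳ-≤-pos (a * b) {{ℚ.positive (*-pos 0<a 0<b)}} (begin
    inv a * (a * b)            ≡⟨ ℚ.*-assoc (inv a) a b ⟨
    inv a * a * b              ≡⟨ cong (_* b) (inv-* 0<a) ⟩
    1ℚ * b                     ≡⟨ ℚ.*-identityˡ b ⟩
    b                          ≤⟨ h ⟩
    a + δ * (c * c)            ≤⟨ ℚ.+-monoʳ-≤ a (ℚ.*-monoˡ-≤-nonNeg δ {{ℚ.nonNegative (ℚ.<⇒≤ 0<δ)}}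
                                    (*-mono (ℚ.<⇒≤ 0<c) (ℚ.<⇒≤ 0<b) c≤a c≤b)) ⟩
    a + δ * (a * b)            ≡⟨ cong (_+ δ * (a * b)) (ℚ.*-identityˡ a) ⟨
    1ℚ * a + δ * (a * b)       ≡⟨ cong (λ u → u * a + δ * (a * b)) (inv-* 0<b) ⟨
    inv b * b * a + δ * (a * b) ≡⟨ solve 4 (λ a b i d → i :* b :* a :+ d :* (a :* b) := (i :+ d) :* (a :* b)) refl a b (inv b) δ ⟩
    (inv b + δ) * (a * b)      ∎)
  where
  open +-*-Solver
  open ℚ.≤-Reasoning
  0<a = ℚ.<-≤-trans 0<c c≤a
  0<b = ℚ.<-≤-trans 0<c c≤b

_*ᴿ_ : ℝ → ℝ → ℝ
seq    (x *ᴿ y) n = seq x n * seq y n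
cauchy (x *ᴿ y) δ 0<δ =
  let A , 0<A , N₁ , f = bounded x
      B , 0<B , N₂ , g = bounded y
      N₃ , h = cauchy x (δ * ½ * inv B) (*-pos (half-pos 0<δ) (inv-pos 0<B))
      N₄ , k = cauchy y (δ * ½ * inv A) (*-pos (half-pos 0<δ) (inv-pos 0<A))
  in (N₁ ℕ.⊔ N₂) ℕ.⊔ (N₃ ℕ.⊔ N₄) , λ m n N≤m N≤n →
       *-near (seq x m) (seq y m) (seq x n) (seq y n) 0<A 0<B
         (f m (ℕ.m⊔n≤o⇒m≤o N₁ N₂ (ℕ.m⊔n≤o⇒m≤o (N₁ ℕ.⊔ N₂) (N₃ ℕ.⊔ N₄) N≤m)))
         (g n (ℕ.m⊔n≤o⇒n≤o N₁ N₂ (ℕ.m⊔n≤o⇒m≤o (N₁ ℕ.⊔ N₂) (N₃ ℕ.⊔ N₄) N≤n)))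
         0<δ
         (h m n (ℕ.m⊔n≤o⇒m≤o N₃ N₄ (ℕ.m⊔n≤o⇒n≤o (N₁ ℕ.⊔ N₂) (N₃ ℕ.⊔ N₄) N≤m)) (ℕ.m⊔n≤o⇒m≤o N₃ N₄ (ℕ.m⊔n≤o⇒n≤o (N₁ ℕ.⊔ N₂) (N₃ ℕ.⊔ N₄) N≤n)))
         (k m n (ℕ.m⊔n≤o⇒n≤o N₃ N₄ (ℕ.m⊔n≤o⇒n≤o (N₁ ℕ.⊔ N₂) (N₃ ℕ.⊔ N₄) N≤m)) (ℕ.m⊔n≤o⇒n≤o N₃ N₄ (ℕ.m⊔n≤o⇒n≤o (N₁ ℕ.⊔ N₂) (N₃ ℕ.⊔ N₄) N≤n)))

recip : (x : ℝ) → 0ᴿ <ᴿ x → ℝ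
seq    (recip x 0<x) n = inv (seq x n)
cauchy (recip x (c , 0<c , N₁ , c≤x)) = cauchy-from-≤ λ δ 0<δ →
  let N₂ , f = cauchy x (δ * (c * c)) (*-pos 0<δ (*-pos 0<c 0<c))
      c≤ = λ i N₁≤i → subst (_≤ seq x i) (ℚ.+-identityˡ c) (c≤x i N₁≤i)
  in N₁ ℕ.⊔ N₂ , λ m n N≤m N≤n →
       inv-near 0<c (c≤ m (ℕ.m⊔n≤o⇒m≤o N₁ N₂ N≤m)) (c≤ n (ℕ.m⊔n≤o⇒m≤o N₁ N₂ N≤n)) 0<δ
         (near⇒≤ (seq x n) (seq x m) (f n m (ℕ.m⊔n≤o⇒n≤o N₁ N₂ N≤n) (ℕ.m⊔n≤o⇒n≤o N₁ N₂ N≤m)))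

toℚᵘ-/ : ∀ a b → ℚ.toℚᵘ (+ a / suc b) ℚᵘ.≃ ℚᵘ.mkℚᵘ (+ a) b
toℚᵘ-/ a b = ℚ.toℚᵘ-fromℚᵘ (ℚᵘ.mkℚᵘ (+ a) b)

/-≤ : ∀ a b c d → a ℕ.* suc d ℕ.≤ c ℕ.* suc b → + a / suc b ≤ + c / suc d
/-≤ a b c d h = ℚ.toℚᵘ-cancel-≤
  (ℚᵘ.≤-respˡ-≃ (ℚᵘ.≃-sym (toℚᵘ-/ a b)) (ℚᵘ.≤-respʳ-≃ (ℚᵘ.≃-sym (toℚᵘ-/ c d))
    (ℚᵘ.*≤* (subst₂ ℤ._≤_ (ℤ.pos-* a (suc d)) (ℤ.pos-* c (suc b)) (ℤ.+≤+ h)))))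

/-+ : ∀ a b n → + a / suc n + + b / suc n ≡ + (a ℕ.+ b) / suc n
/-+ a b n = ℚ.toℚᵘ-injective (begin-equality
  ℚ.toℚᵘ (+ a / suc n + + b / suc n)               ≃⟨ ℚ.toℚᵘ-homo-+ (+ a / suc n) (+ b / suc n) ⟩
  ℚ.toℚᵘ (+ a / suc n) ℚᵘ.+ ℚ.toℚᵘ (+ b / suc n)   ≃⟨ ℚᵘ.+-cong (toℚᵘ-/ a n) (toℚᵘ-/ b n) ⟩
  ℚᵘ.mkℚᵘ (+ a) n ℚᵘ.+ ℚᵘ.mkℚᵘ (+ b) n             ≃⟨ ℚᵘ.*≡* eq ⟩
  ℚᵘ.mkℚᵘ (+ (a ℕ.+ b)) n                          ≃⟨ toℚᵘ-/ (a ℕ.+ b) n ⟨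
  ℚ.toℚᵘ (+ (a ℕ.+ b) / suc n)                     ∎)
  where
  open ℚᵘ.≤-Reasoning
  d = + suc n
  eq : (+ a ℤ.* d ℤ.+ + b ℤ.* d) ℤ.* d ≡ (+ a ℤ.+ + b) ℤ.* (d ℤ.* d)
  eq = trans (cong (ℤ._* d) (sym (ℤ.*-distribʳ-+ d (+ a) (+ b)))) (ℤ.*-assoc (+ a ℤ.+ + b) d d)

archimedean : ∀ δ → 0ℚ < δ → ∃[ N ] ∀ n → N ℕ.≤ n → + 1 / suc n ≤ δ
archimedean δ@(ℚ.mkℚ (+ suc p) d _) 0<δ = d , λ n d≤n →
  subst (+ 1 / suc n ≤_) (ℚ.↥p/↧p≡p δ) (/-≤ 1 n (suc p) d
    (ℕ.≤-trans (ℕ.≤-reflexive (ℕ.*-identityˡ (suc d)))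
      (ℕ.≤-trans (ℕ.s≤s d≤n) (ℕ.m≤m+n (suc n) (p ℕ.* suc n)))))
archimedean (ℚ.mkℚ (+ zero) _ _) (*<* (ℤ.+<+ ()))
archimedean (ℚ.mkℚ ℤ.-[1+ _ ] _ _) (*<* ())

unit-pos : ∀ n → 0ℚ < + 1 / suc n
unit-pos n = ℚ.positive⁻¹ (+ 1 / suc n) {{ℚ.normalize-pos 1 (suc n)}}

cauchy-from-1/n : ∀ {s} → (∀ m n → s m ≤ s n + + 1 / suc n) → IsCauchy s
cauchy-from-1/n {s} h = cauchy-from-≤ λ δ 0<δ →
  let N , f = archimedean δ 0<δ
  in N , λ m n _ N≤n → ℚ.≤-trans (h m n) (ℚ.+-monoʳ-≤ (s n) (f n N≤n))

⌊√_⌋ : ℕ → ℕ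
⌊√ zero ⌋  = zero
⌊√ suc n ⌋ with suc ⌊√ n ⌋ ℕ.* suc ⌊√ n ⌋ ℕ.≤? suc n
... | yes _ = suc ⌊√ n ⌋
... | no  _ = ⌊√ n ⌋

⌊√⌋-lower : ∀ n → ⌊√ n ⌋ ℕ.* ⌊√ n ⌋ ℕ.≤ n
⌊√⌋-lower zero = ℕ.z≤n
⌊√⌋-lower (suc n) with suc ⌊√ n ⌋ ℕ.* suc ⌊√ n ⌋ ℕ.≤? suc n
... | yes p = p
... | no  _ = ℕ.m≤n⇒m≤1+n (⌊√⌋-lower n)

⌊√⌋-upper : ∀ n → n ℕ.< suc ⌊√ n ⌋ ℕ.* suc ⌊√ n ⌋
⌊√⌋-upper zero = ℕ.s≤s ℕ.z≤n
⌊√⌋-upper (suc n) with suc ⌊√ n ⌋ ℕ.* suc ⌊√ n ⌋ ℕ.≤? suc n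
... | yes _ = ℕ.<-≤-trans (ℕ.s≤s (⌊√⌋-upper n)) (ℕ.*-mono-< (ℕ.n<1+n (suc ⌊√ n ⌋)) (ℕ.n<1+n (suc ⌊√ n ⌋)))
... | no ¬p = ℕ.≰⇒> ¬p

√-seq : ℕ → ℕ → ℚ
√-seq n m = + ⌊√ n ℕ.* (suc m ℕ.* suc m) ⌋ / suc m

cross : ∀ n M K → ⌊√ n ℕ.* (M ℕ.* M) ⌋ ℕ.* K ℕ.≤ suc ⌊√ n ℕ.* (K ℕ.* K) ⌋ ℕ.* M
cross n M K = ℕ.≮⇒≥ λ lt → ℕ.<-irrefl refl (begin-strict
  (suc b ℕ.* M) ℕ.* (suc b ℕ.* M)   <⟨ ℕ.*-mono-< lt lt ⟩
  (a ℕ.* K) ℕ.* (a ℕ.* K)           ≡⟨ solve 2 (λ a K → (a :* K) :* (a :* K) := (a :* a) :* (K :* K)) refl a K ⟩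
  (a ℕ.* a) ℕ.* (K ℕ.* K)           ≤⟨ ℕ.*-monoˡ-≤ (K ℕ.* K) (⌊√⌋-lower (n ℕ.* (M ℕ.* M))) ⟩
  n ℕ.* (M ℕ.* M) ℕ.* (K ℕ.* K)     ≡⟨ solve 3 (λ n M K → n :* (M :* M) :* (K :* K) := n :* (K :* K) :* (M :* M)) refl n M K ⟩
  n ℕ.* (K ℕ.* K) ℕ.* (M ℕ.* M)     ≤⟨ ℕ.*-monoˡ-≤ (M ℕ.* M) (ℕ.<⇒≤ (⌊√⌋-upper (n ℕ.* (K ℕ.* K)))) ⟩
  (suc b ℕ.* suc b) ℕ.* (M ℕ.* M)   ≡⟨ solve 2 (λ b M → (b :* b) :* (M :* M) := (b :* M) :* (b :* M)) refl (suc b) M ⟩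
  (suc b ℕ.* M) ℕ.* (suc b ℕ.* M)   ∎)
  where
  open ℕ.≤-Reasoning
  open ℕ-Solver.+-*-Solver
  a = ⌊√ n ℕ.* (M ℕ.* M) ⌋
  b = ⌊√ n ℕ.* (K ℕ.* K) ⌋

-- With M = m + 1, the m-th approximation is ⌊√n · M⌋ / M.
√ : ℕ → ℝ
seq    (√ n) = √-seq n
cauchy (√ n) = cauchy-from-1/n λ m k →
  let a = ⌊√ n ℕ.* (suc m ℕ.* suc m) ⌋
      b = ⌊√ n ℕ.* (suc k ℕ.* suc k) ⌋
  in subst (√-seq n m ≤_)
       (trans (cong (λ t → + t / suc k) (ℕ.+-comm 1 b)) (sym (/-+ b 1 k)))
       (/-≤ a m (suc b) k (cross n (suc m) (suc k)))

√-pos : ∀ n → 0ᴿ <ᴿ √ (suc n)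
√-pos n = 1ℚ , ℚ.positive⁻¹ 1ℚ , 0 , λ m _ →
  let M = suc m
      a = ⌊√ suc n ℕ.* (M ℕ.* M) ⌋
  in subst (_≤ √-seq (suc n) m) (sym (ℚ.+-identityˡ 1ℚ)) (/-≤ 1 0 a m (ℕ.≮⇒≥ λ lt →
       let a<M = subst₂ ℕ._<_ (ℕ.*-identityʳ a) (ℕ.*-identityˡ M) lt
       in ℕ.<-irrefl refl (ℕ.<-≤-trans (⌊√⌋-upper (suc n ℕ.* (M ℕ.* M)))
            (ℕ.≤-trans (ℕ.*-mono-≤ a<M a<M) (ℕ.m≤m+n (M ℕ.* M) (n ℕ.* (M ℕ.* M)))))))

sumℚ : ℕ → (ℕ → ℚ) → ℚ
sumℚ zero    f = 0ℚ
sumℚ (suc l) f = sumℚ l f + f l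

sumℚ-mono : ∀ l {f g} → (∀ i → i ℕ.< l → f i ≤ g i) → sumℚ l f ≤ sumℚ l g
sumℚ-mono zero    h = ℚ.≤-refl
sumℚ-mono (suc l) h = ℚ.+-mono-≤ (sumℚ-mono l (λ i i<l → h i (ℕ.m<n⇒m<1+n i<l))) (h l (ℕ.n<1+n l))

sumℚ-++ : ∀ a b f → sumℚ (b ℕ.+ a) f ≡ sumℚ a f + sumℚ b (λ j → f (a ℕ.+ j))
sumℚ-++ a zero    f = sym (ℚ.+-identityʳ (sumℚ a f))
sumℚ-++ a (suc b) f = trans
  (cong₂ _+_ (sumℚ-++ a b f) (cong f (ℕ.+-comm b a)))
  (ℚ.+-assoc (sumℚ a f) (sumℚ b (λ j → f (a ℕ.+ j))) (f (a ℕ.+ b)))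

sumℚ-blocks : ∀ l K f → sumℚ (l ℕ.* K) f ≡ sumℚ l (λ i → sumℚ K (λ j → f (i ℕ.* K ℕ.+ j)))
sumℚ-blocks zero    K f = refl
sumℚ-blocks (suc l) K f = trans (sumℚ-++ (l ℕ.* K) K f)
  (cong (_+ sumℚ K (λ j → f (l ℕ.* K ℕ.+ j))) (sumℚ-blocks l K f))

sumℚ-unit : ∀ l n → sumℚ l (λ _ → + 1 / suc n) ≡ + l / suc n
sumℚ-unit zero    n = sym (ℚ.0/n≡0 (suc n))
sumℚ-unit (suc l) n = trans (cong (_+ + 1 / suc n) (sumℚ-unit l n))
  (trans (/-+ l 1 n) (cong (λ t → + t / suc n) (ℕ.+-comm l 1)))

log-seq : ℕ → ℕ → ℚ
log-seq n m = sumℚ (pred n ℕ.* suc m) (λ i → + 1 / suc (suc m ℕ.+ i))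

shift : ∀ l m → sumℚ l (λ i → + 1 / suc (m ℕ.+ i)) + + 1 / suc (m ℕ.+ l)
              ≡ sumℚ l (λ i → + 1 / suc (suc m ℕ.+ i)) + + 1 / suc m
shift zero    m = cong (λ t → 0ℚ + + 1 / suc t) (ℕ.+-identityʳ m)
shift (suc l) m = begin
  A + u + v    ≡⟨ cong (_+ v) (shift l m) ⟩
  B + w + v    ≡⟨ solve 3 (λ a b c → a :+ b :+ c := a :+ c :+ b) refl B w v ⟩
  B + v + w    ≡⟨ cong (λ t → B + + 1 / suc t + w) (ℕ.+-suc m l) ⟩
  B + + 1 / suc (suc m ℕ.+ l) + w ∎
  where
  open +-*-Solver
  open ≡-Reasoning
  A = sumℚ l (λ i → + 1 / suc (m ℕ.+ i))
  B = sumℚ l (λ i → + 1 / suc (suc m ℕ.+ i))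
  u = + 1 / suc (m ℕ.+ l)
  v = + 1 / suc (m ℕ.+ suc l)
  w = + 1 / suc m

-- The mesh 1/((m+1)(k+1)), as an index.
refine : ℕ → ℕ → ℕ
refine m k = k ℕ.+ m ℕ.* suc k

module _ (n m k : ℕ) where

  private
    M = suc m
    K = suc k
    f : ℕ → ℚ
    f i = + 1 / suc (M ℕ.* K ℕ.+ i)

  log-seq-blocks : log-seq n (refine m k) ≡ sumℚ (pred n ℕ.* M) (λ i → sumℚ K (λ j → f (i ℕ.* K ℕ.+ j)))
  log-seq-blocks = trans (cong (λ t → sumℚ t f) (sym (ℕ.*-assoc (pred n) M K))) (sumℚ-blocks (pred n ℕ.* M) K f)

  block-lower : ∀ i → + 1 / suc (M ℕ.+ i) ≤ sumℚ K (λ j → f (i ℕ.* K ℕ.+ j))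
  block-lower i = begin
    + 1 / suc (M ℕ.+ i)                   ≤⟨ /-≤ 1 _ K (refine (M ℕ.+ i) k) (ℕ.≤-reflexive
                                               (trans (ℕ.*-identityˡ _) (ℕ.*-comm (suc (M ℕ.+ i)) K))) ⟩
    + K / suc (refine (M ℕ.+ i) k)        ≡⟨ sumℚ-unit K (refine (M ℕ.+ i) k) ⟨
    sumℚ K (λ _ → + 1 / suc (refine (M ℕ.+ i) k)) ≤⟨ sumℚ-mono K (λ j j<K → /-≤ 1 _ 1 _ (ℕ.*-monoʳ-≤ 1 (bound j j<K))) ⟩
    sumℚ K (λ j → f (i ℕ.* K ℕ.+ j))      ∎
    where
    open ℚ.≤-Reasoning
    open ℕ-Solver.+-*-Solver
    bound : ∀ j → j ℕ.< K → suc (M ℕ.* K ℕ.+ (i ℕ.* K ℕ.+ j)) ℕ.≤ suc (M ℕ.+ i) ℕ.* K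
    bound j j<K = subst₂ ℕ._≤_
      (solve 4 (λ M K i j → M :* K :+ i :* K :+ (con 1 :+ j) := con 1 :+ (M :* K :+ (i :* K :+ j))) refl M K i j)
      (solve 3 (λ M K i → M :* K :+ i :* K :+ K := (con 1 :+ (M :+ i)) :* K) refl M K i)
      (ℕ.+-monoʳ-≤ (M ℕ.* K ℕ.+ i ℕ.* K) j<K)

  block-upper : ∀ i → sumℚ K (λ j → f (i ℕ.* K ℕ.+ j)) ≤ + 1 / suc (m ℕ.+ i)
  block-upper i = begin
    sumℚ K (λ j → f (i ℕ.* K ℕ.+ j))      ≤⟨ sumℚ-mono K (λ j _ → /-≤ 1 _ 1 _ (ℕ.*-monoʳ-≤ 1 (bound j))) ⟩
    sumℚ K (λ _ → + 1 / suc (refine (m ℕ.+ i) k)) ≡⟨ sumℚ-unit K (refine (m ℕ.+ i) k) ⟩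
    + K / suc (refine (m ℕ.+ i) k)        ≤⟨ /-≤ K (refine (m ℕ.+ i) k) 1 _ (ℕ.≤-reflexive
                                               (trans (ℕ.*-comm K (suc (m ℕ.+ i))) (sym (ℕ.*-identityˡ _)))) ⟩
    + 1 / suc (m ℕ.+ i)                   ∎
    where
    open ℚ.≤-Reasoning
    open ℕ-Solver.+-*-Solver
    bound : ∀ j → suc (m ℕ.+ i) ℕ.* K ℕ.≤ suc (M ℕ.* K ℕ.+ (i ℕ.* K ℕ.+ j))
    bound j = ℕ.≤-trans (ℕ.m≤m+n _ (suc j)) (ℕ.≤-reflexive
      (solve 4 (λ m K i j → (con 1 :+ (m :+ i)) :* K :+ (con 1 :+ j) := con 1 :+ ((con 1 :+ m) :* K :+ (i :* K :+ j))) refl m K i j))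

  refine-lower : log-seq n m ≤ log-seq n (refine m k)
  refine-lower = subst (log-seq n m ≤_) (sym log-seq-blocks) (sumℚ-mono (pred n ℕ.* M) (λ i _ → block-lower i))

  refine-upper : log-seq n (refine m k) ≤ log-seq n m + + 1 / suc m
  refine-upper = begin
    log-seq n (refine m k)                            ≡⟨ log-seq-blocks ⟩
    sumℚ l (λ i → sumℚ K (λ j → f (i ℕ.* K ℕ.+ j)))   ≤⟨ sumℚ-mono l (λ i _ → block-upper i) ⟩
    sumℚ l (λ i → + 1 / suc (m ℕ.+ i))                ≡⟨ ℚ.+-identityʳ (sumℚ l (λ i → + 1 / suc (m ℕ.+ i))) ⟨
    sumℚ l (λ i → + 1 / suc (m ℕ.+ i)) + 0ℚ           ≤⟨ ℚ.+-monoʳ-≤ (sumℚ l (λ i → + 1 / suc (m ℕ.+ i))) (ℚ.<⇒≤ (unit-pos (m ℕ.+ l))) ⟩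
    sumℚ l (λ i → + 1 / suc (m ℕ.+ i)) + + 1 / suc (m ℕ.+ l) ≡⟨ shift l m ⟩
    log-seq n m + + 1 / suc m                         ∎
    where
    open ℚ.≤-Reasoning
    l = pred n ℕ.* M

-- log n = ∫₁ⁿ dt/t for n ≥ 1: with M = m + 1, the m-th approximation is the
-- right Riemann sum of mesh 1/M, namely Σ_{M < j ≤ nM} 1/j.  (log 0 is 0.)
log : ℕ → ℝ
seq    (log n) = log-seq n
cauchy (log n) = cauchy-from-1/n λ m k → ℚ.≤-trans (refine-lower n m k)
  (subst (λ t → log-seq n t ≤ log-seq n k + + 1 / suc k)
    (solve 2 (λ m k → m :+ k :* (con 1 :+ m) := k :+ m :* (con 1 :+ k)) refl m k) (refine-upper n k m))
  where
  open ℕ-Solver.+-*-Solver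

log2-pos : 0ᴿ <ᴿ log 2
log2-pos = ½ , 0<½ , 0 , λ m _ → let M = suc m in begin
  0ℚ + ½                                  ≡⟨ ℚ.+-identityˡ ½ ⟩
  + 1 / 2                                 ≤⟨ /-≤ 1 1 (1 ℕ.* M) (m ℕ.+ M) (ℕ.≤-reflexive
                                               (solve 1 (λ m → con 1 :* (con 1 :+ m :+ (con 1 :+ m)) := con 1 :* (con 1 :+ m) :* con 2) refl m)) ⟩
  + (1 ℕ.* M) / suc (m ℕ.+ M)             ≡⟨ sumℚ-unit (1 ℕ.* M) (m ℕ.+ M) ⟨
  sumℚ (1 ℕ.* M) (λ _ → + 1 / suc (m ℕ.+ M)) ≤⟨ sumℚ-mono (1 ℕ.* M) (λ i i<M → /-≤ 1 _ 1 _ (ℕ.*-monoʳ-≤ 1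
                                               (ℕ.s≤s (subst (ℕ._≤ m ℕ.+ M) (ℕ.+-suc m i)
                                                 (ℕ.+-monoʳ-≤ m (subst (suc i ℕ.≤_) (ℕ.*-identityˡ M) i<M)))))) ⟩
  seq (log 2) m                           ∎
  where
  open ℚ.≤-Reasoning
  open ℕ-Solver.+-*-Solver

lg : ℕ → ℝ
lg n = log n *ᴿ recip (log 2) log2-pos

-- A terminating program that may toss coins: flip q tosses a fresh coin, independent
-- of all previous ones, which comes up true with probability q.
data Rand (A : Set) : Set where
  return : A → Rand A
  flip   : ℝ → (Bool → Rand A) → Rand A

infixl 1 _>>=_

_>>=_ : ∀ {A B} → Rand A → (A → Rand B) → Rand B
return a >>= f = f a
flip q k >>= f = flip q (λ b → k b >>= f)

𝔼 : ∀ {A} → (A → ℝ) → Rand A → ℝ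
𝔼 X (return a) = X a
𝔼 X (flip q k) = q *ᴿ 𝔼 X (k true) +ᴿ (1ᴿ -ᴿ q) *ᴿ 𝔼 X (k false)

-- An unordered pair of distinct words is represented by (x , y) with x < y.
Key : ℕ → Set
Key D = Fin D × Fin D

pairs : ∀ {D} → Subset D → List (Key D)
pairs {D} t = filter (λ (x , y) → x <? y ×-dec x ∈? t ×-dec y ∈? t)
                     (cartesianProduct (allFin D) (allFin D))

HashMap : ℕ → Set
HashMap D = List (Key D × List ℝ)

insert : ∀ {D} → Key D → ℝ → HashMap D → HashMap D
insert k v [] = (k , v ∷ []) ∷ []
insert k v ((k′ , bag) ∷ H) with ≡-dec _≟ᶠ_ _≟ᶠ_ k k′
... | yes _ = (k′ , v ∷ bag) ∷ H
... | no  _ = (k′ , bag) ∷ insert k v H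

record State (D : ℕ) : Set where
  field
    counters : Vec ℕ D
    H        : HashMap D

open State public

empty : ∀ {D} → State D
empty {D} = record { counters = replicate D 0 ; H = [] }

-- One unit for each key, each stored number and each counter.
size : ∀ {D} → HashMap D → ℕ
size H = sum (map (λ (_ , bag) → suc (length bag)) H)

memory : ∀ {D} → State D → ℕ
memory {D} s = D ℕ.+ size (H s)

count : ∀ {D} → Subset D → Vec ℕ D → Vec ℕ D
count = zipWith (λ x∈t c → if x∈t then suc c else c)

module Streaming (D : ℕ) (ε : ℝ) (0<ε : 0ᴿ <ᴿ ε) where

  p : ℝ
  p = fromℕ 2 *ᴿ log D

  -- The argument is #(x)#(y), which is positive whenever x and y occur in the
  -- current document; the value at 0 is never used.
  coin : ℕ → ℝ
  coin zero      = 1ᴿ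
  coin c@(suc n) = 1ᴿ ⊓ᴿ (p *ᴿ recip ε 0<ε *ᴿ recip (√ c) (√-pos n))

  sample : Vec ℕ D → List (Key D) → HashMap D → Rand (HashMap D)
  sample # []             H = return H
  sample # ((x , y) ∷ ps) H = flip q λ heads → sample # ps (if heads then insert (x , y) q H else H)
    where q = coin (lookup # x ℕ.* lookup # y)

  arrive : Subset D → State D → Rand (State D)
  arrive t s = sample # (pairs t) (H s) >>= λ H′ → return (record { counters = # ; H = H′ })
    where # = count t (counters s)

  process : ∀ {N} → Vec (Subset D) N → State D → Rand (State D)
  process []       s = return s
  process (t ∷ ts) s = arrive t s >>= process ts

  expectedMemory : ∀ {N} → Vec (Subset D) N → ℝ
  expectedMemory ts = 𝔼 (λ s → fromℕ (memory s)) (process ts empty)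

{-# OPTIONS --safe #-}
module Submission where

-- A coin with counters a, b has rate p/(ε√(ab)), and 1/√(ab) is at most
-- 1/a + 1/b by AM-GM.  Summed over the pairs of a document, the expected growth
-- of H is O(pL/ε) times Σ 1/#(x) over the words x of the document, and this sum is
-- exactly the increase of the potential Σ_x (1 + 1/2 + ⋯ + 1/#(x)), which never
-- exceeds D (1 + ⋯ + 1/N) = O(D lg N).  Every real involved is bounded at each
-- sufficiently large index of its Cauchy sequence, so no limits are taken.

open import Defs
open import Data.Bool using (true; false; if_then_else_)
open import Data.Fin using (Fin)
open import Data.Fin.Subset using (Subset; ∣_∣)
open import Data.Integer using (+_)
import Data.Integer as ℤ
import Data.Integer.Properties as ℤ
open import Data.List using (List; []; _∷_; _++_; map; filter; length; allFin; cartesianProduct; tabulate)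
open import Data.List.Properties using (map-tabulate; length-tabulate)
open import Data.Nat using (ℕ; zero; suc; _≤_)
import Data.Nat as ℕ
import Data.Nat.Properties as ℕ
import Data.Nat.Solver as ℕ-Solver
open import Data.Product using (Σ-syntax; _,_)
open import Data.Product.Properties using (≡-dec)
open import Data.Fin.Properties using () renaming (_≟_ to _≟ᶠ_)
open import Data.Rational using (ℚ; 0ℚ; 1ℚ; ½; _/_; _+_; _*_; _-_; -_; _<_)
import Data.Rational as ℚ
import Data.Rational.Properties as ℚ
open import Data.Rational.Solver using (module +-*-Solver)
import Data.Rational.Unnormalised as ℚᵘ
import Data.Rational.Unnormalised.Properties as ℚᵘ
open import Data.Sum using (inj₁; inj₂)
open import Data.Vec using (Vec; []; _∷_; lookup)
open import Data.Vec.Properties using (lookup-zipWith; lookup-replicate; []=⇒lookup)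
open import Data.Vec.Relation.Unary.All using (All; []; _∷_)
open import Relation.Binary.PropositionalEquality using (_≡_; refl; sym; trans; cong; cong₂; subst; subst₂; module ≡-Reasoning)
open import Relation.Nullary using (yes; no)
open import Relation.Unary using (Decidable)

-- Rational arithmetic.

ι : ℕ → ℚ
ι k = + k / 1

ι-mono : ∀ {a b} → a ≤ b → ι a ℚ.≤ ι b
ι-mono {a} {b} a≤b = /-≤ a 0 b 0 (ℕ.*-monoˡ-≤ 1 a≤b)

0≤ι : ∀ k → 0ℚ ℚ.≤ ι k
0≤ι k = ι-mono {0} {k} ℕ.z≤n

+-nonNeg : ∀ {p q} → 0ℚ ℚ.≤ p → 0ℚ ℚ.≤ q → 0ℚ ℚ.≤ p + q
+-nonNeg = ℚ.+-mono-≤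

*-nonNeg : ∀ {p q} → 0ℚ ℚ.≤ p → 0ℚ ℚ.≤ q → 0ℚ ℚ.≤ p * q
*-nonNeg {p} {q} 0≤p 0≤q = subst (ℚ._≤ p * q) (ℚ.*-zeroˡ 0ℚ) (*-mono ℚ.≤-refl 0≤q 0≤p 0≤q)

*-monoˡ : ∀ {p q r} → 0ℚ ℚ.≤ r → p ℚ.≤ q → r * p ℚ.≤ r * q
*-monoˡ {r = r} 0≤r = ℚ.*-monoˡ-≤-nonNeg r {{ℚ.nonNegative 0≤r}}

≤-+ʳ : ∀ {p q r} → 0ℚ ℚ.≤ r → p ℚ.≤ q → p ℚ.≤ q + r
≤-+ʳ {p} 0≤r p≤q = subst (ℚ._≤ _) (ℚ.+-identityʳ p) (ℚ.+-mono-≤ p≤q 0≤r)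

/-* : ∀ a m b n → + a / suc m * (+ b / suc n) ≡ + (a ℕ.* b) / (suc m ℕ.* suc n)
/-* a m b n = ℚ.toℚᵘ-injective (begin-equality
  ℚ.toℚᵘ (+ a / suc m * (+ b / suc n))             ≃⟨ ℚ.toℚᵘ-homo-* (+ a / suc m) (+ b / suc n) ⟩
  ℚ.toℚᵘ (+ a / suc m) ℚᵘ.* ℚ.toℚᵘ (+ b / suc n)   ≃⟨ ℚᵘ.*-cong (toℚᵘ-/ a m) (toℚᵘ-/ b n) ⟩
  ℚᵘ.mkℚᵘ (+ a) m ℚᵘ.* ℚᵘ.mkℚᵘ (+ b) n             ≃⟨ ℚᵘ.*≡* (cong (ℤ._* (+ (suc m ℕ.* suc n))) (sym (ℤ.pos-* a b))) ⟩
  ℚᵘ.mkℚᵘ (+ (a ℕ.* b)) (n ℕ.+ m ℕ.* suc n)        ≃⟨ toℚᵘ-/ (a ℕ.* b) (n ℕ.+ m ℕ.* suc n) ⟨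
  ℚ.toℚᵘ (+ (a ℕ.* b) / (suc m ℕ.* suc n))         ∎)
  where
  open ℚᵘ.≤-Reasoning

inv≤ : ∀ {s r} → 0ℚ < s → 1ℚ ℚ.≤ r * s → inv s ℚ.≤ r
inv≤ {s} {r} 0<s 1≤rs = ℚ.*-cancelʳ-≤-pos s {{ℚ.positive 0<s}} (subst (ℚ._≤ r * s) (sym (inv-* 0<s)) 1≤rs)

≤inv : ∀ {s r} → 0ℚ < s → r * s ℚ.≤ 1ℚ → r ℚ.≤ inv s
≤inv {s} {r} 0<s rs≤1 = ℚ.*-cancelʳ-≤-pos s {{ℚ.positive 0<s}} (subst (r * s ℚ.≤_) (sym (inv-* 0<s)) rs≤1)

-- The bound 1/√(ab) ≤ 1/a + 1/b at every index.

sq-cancel-≤ : ∀ {a b} → a ℕ.* a ≤ b ℕ.* b → a ≤ b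
sq-cancel-≤ {a} {b} a²≤b² = ℕ.≮⇒≥ λ b<a → ℕ.<⇒≱ (ℕ.*-mono-< b<a b<a) a²≤b²

-- With b = a + d, the right side exceeds the left by exactly d². Ordering the two numbers avoids
-- subtraction in `ℕ`.
am-gm-ordered : ∀ {a b} → a ≤ b → 4 ℕ.* (a ℕ.* b) ≤ (a ℕ.+ b) ℕ.* (a ℕ.+ b)
am-gm-ordered {a} a≤b with d , refl ← ℕ.m≤n⇒∃[o]m+o≡n a≤b = ℕ.≤-trans (ℕ.m≤m+n _ (d ℕ.* d)) (ℕ.≤-reflexive
  (solve 2 (λ a d → con 4 :* (a :* (a :+ d)) :+ d :* d := (a :+ (a :+ d)) :* (a :+ (a :+ d))) refl a d))
  where
  open ℕ-Solver.+-*-Solver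

am-gm : ∀ a b → 4 ℕ.* (a ℕ.* b) ≤ (a ℕ.+ b) ℕ.* (a ℕ.+ b)
am-gm a b with ℕ.≤-total a b
... | inj₁ a≤b = am-gm-ordered a≤b
... | inj₂ b≤a = subst₂ _≤_ (cong (4 ℕ.*_) (ℕ.*-comm b a)) (cong₂ ℕ._*_ (ℕ.+-comm b a) (ℕ.+-comm b a)) (am-gm-ordered b≤a)

1≤⌊√⌋ : ∀ n → 1 ≤ n → 1 ≤ ⌊√ n ⌋
1≤⌊√⌋ n 1≤n = ℕ.≮⇒≥ λ r<1 → ℕ.<⇒≱ (⌊√⌋-upper n) (ℕ.≤-trans (ℕ.*-mono-≤ r<1 r<1) 1≤n)

-- Rounding costs at most a factor 2 since r ≥ 1, and a factor 2 is what
-- the AM-GM inequality has to spare.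
√-product-lower : ∀ a′ b′ m → let a = suc a′ ; b = suc b′ ; M = suc m in
                  M ℕ.* (a ℕ.* b) ≤ (a ℕ.+ b) ℕ.* ⌊√ a ℕ.* b ℕ.* (M ℕ.* M) ⌋
√-product-lower a′ b′ m = sq-cancel-≤ (begin
  (M ℕ.* (a ℕ.* b)) ℕ.* (M ℕ.* (a ℕ.* b))             ≡⟨ solve 2 (λ M c → (M :* c) :* (M :* c) := c :* (c :* (M :* M))) refl M (a ℕ.* b) ⟩
  a ℕ.* b ℕ.* (a ℕ.* b ℕ.* (M ℕ.* M))                 ≤⟨ ℕ.*-monoʳ-≤ (a ℕ.* b) (ℕ.<⇒≤ (⌊√⌋-upper (a ℕ.* b ℕ.* (M ℕ.* M)))) ⟩
  a ℕ.* b ℕ.* (suc r ℕ.* suc r)                       ≤⟨ ℕ.*-monoʳ-≤ (a ℕ.* b) (ℕ.*-mono-≤ (ℕ.+-monoˡ-≤ r 1≤r) (ℕ.+-monoˡ-≤ r 1≤r)) ⟩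
  a ℕ.* b ℕ.* ((r ℕ.+ r) ℕ.* (r ℕ.+ r))               ≡⟨ solve 2 (λ c r → c :* ((r :+ r) :* (r :+ r)) := con 4 :* c :* (r :* r)) refl (a ℕ.* b) r ⟩
  4 ℕ.* (a ℕ.* b) ℕ.* (r ℕ.* r)                       ≤⟨ ℕ.*-monoˡ-≤ (r ℕ.* r) (am-gm a b) ⟩
  (a ℕ.+ b) ℕ.* (a ℕ.+ b) ℕ.* (r ℕ.* r)               ≡⟨ solve 2 (λ s r → s :* s :* (r :* r) := (s :* r) :* (s :* r)) refl (a ℕ.+ b) r ⟩
  ((a ℕ.+ b) ℕ.* r) ℕ.* ((a ℕ.+ b) ℕ.* r)             ∎)
  where
  open ℕ.≤-Reasoning
  open ℕ-Solver.+-*-Solver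
  a = suc a′
  b = suc b′
  M = suc m
  r = ⌊√ a ℕ.* b ℕ.* (M ℕ.* M) ⌋
  1≤r : 1 ≤ r
  1≤r = 1≤⌊√⌋ (a ℕ.* b ℕ.* (M ℕ.* M)) (ℕ.s≤s ℕ.z≤n)

√-seq-pos : ∀ n m → 0ℚ < √-seq (suc n) m
√-seq-pos n m = let _ , _ , _ , 1≤√ = √-pos n in ℚ.<-≤-trans (ℚ.positive⁻¹ 1ℚ) (1≤√ m ℕ.z≤n)

-- As 1/a + 1/b = (a + b)/(ab), the last hypothesis is the conclusion with its denominators cleared.
1/fraction≤ : ∀ a′ b′ m r → let a = suc a′ ; b = suc b′ in 0ℚ < + r / suc m →
              suc m ℕ.* (a ℕ.* b) ≤ (a ℕ.+ b) ℕ.* r → inv (+ r / suc m) ℚ.≤ + 1 / a + + 1 / b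
1/fraction≤ a′ b′ m r 0<s Mab≤ = inv≤ 0<s (begin
  1ℚ                                       ≤⟨ /-≤ 1 0 ((a ℕ.+ b) ℕ.* r) (m ℕ.+ k ℕ.* suc m) bound ⟩
  + ((a ℕ.+ b) ℕ.* r) / (suc k ℕ.* suc m)  ≡⟨ /-* (a ℕ.+ b) k r m ⟨
  + (a ℕ.+ b) / suc k * s                  ≤⟨ ℚ.*-monoʳ-≤-nonNeg s {{ℚ.nonNegative (ℚ.<⇒≤ 0<s)}} sum≤ ⟩
  (+ 1 / a + + 1 / b) * s                  ∎)
  where
  open ℚ.≤-Reasoning
  a = suc a′
  b = suc b′
  -- Chosen so that `suc k` is definitionally the product ab.
  k = b′ ℕ.+ a′ ℕ.* b
  s = + r / suc m
  bound : 1 ℕ.* (suc k ℕ.* suc m) ≤ (a ℕ.+ b) ℕ.* r ℕ.* 1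
  bound = subst₂ _≤_ (trans (ℕ.*-comm (suc m) (suc k)) (sym (ℕ.*-identityˡ (suc k ℕ.* suc m))))
    (sym (ℕ.*-identityʳ ((a ℕ.+ b) ℕ.* r))) Mab≤
  sum≤ : + (a ℕ.+ b) / suc k ℚ.≤ + 1 / a + + 1 / b
  sum≤ = subst (ℚ._≤ + 1 / a + + 1 / b) (trans (/-+ b a k) (cong (λ t → + t / suc k) (ℕ.+-comm b a)))
    (ℚ.+-mono-≤ (/-≤ b k 1 a′ (ℕ.≤-reflexive (trans (ℕ.*-comm b a) (sym (ℕ.*-identityˡ (suc k))))))
                (/-≤ a k 1 b′ (ℕ.≤-reflexive (sym (ℕ.*-identityˡ (suc k))))))

1/√≤ : ∀ a b m → inv (√-seq (suc a ℕ.* suc b) m) ℚ.≤ + 1 / suc a + + 1 / suc b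
1/√≤ a b m = 1/fraction≤ a b m ⌊√ suc a ℕ.* suc b ℕ.* (suc m ℕ.* suc m) ⌋
  (√-seq-pos (b ℕ.+ a ℕ.* suc b) m) (√-product-lower a b m)

-- Finite sums over lists.

∑ : ∀ {A : Set} → List A → (A → ℚ) → ℚ
∑ []       f = 0ℚ
∑ (x ∷ xs) f = f x + ∑ xs f

module _ {A : Set} where

  ∑-mono : ∀ (xs : List A) {f g} → (∀ x → f x ℚ.≤ g x) → ∑ xs f ℚ.≤ ∑ xs g
  ∑-mono []       f≤g = ℚ.≤-refl
  ∑-mono (x ∷ xs) f≤g = ℚ.+-mono-≤ (f≤g x) (∑-mono xs f≤g)

  ∑-cong : ∀ (xs : List A) {f g} → (∀ x → f x ≡ g x) → ∑ xs f ≡ ∑ xs g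
  ∑-cong []       f≡g = refl
  ∑-cong (x ∷ xs) f≡g = cong₂ _+_ (f≡g x) (∑-cong xs f≡g)

  ∑-+ : ∀ (xs : List A) f g → ∑ xs (λ x → f x + g x) ≡ ∑ xs f + ∑ xs g
  ∑-+ []       f g = refl
  ∑-+ (x ∷ xs) f g = trans (cong (λ s → f x + g x + s) (∑-+ xs f g))
    (solve 4 (λ a b c d → (a :+ b) :+ (c :+ d) := (a :+ c) :+ (b :+ d)) refl (f x) (g x) (∑ xs f) (∑ xs g))
    where
    open +-*-Solver

  ∑-*ˡ : ∀ (xs : List A) c f → ∑ xs (λ x → c * f x) ≡ c * ∑ xs f
  ∑-*ˡ []       c f = sym (ℚ.*-zeroʳ c)
  ∑-*ˡ (x ∷ xs) c f = trans (cong (λ s → c * f x + s) (∑-*ˡ xs c f)) (sym (ℚ.*-distribˡ-+ c (f x) (∑ xs f)))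

  ∑-nonNeg : ∀ (xs : List A) {f} → (∀ x → 0ℚ ℚ.≤ f x) → 0ℚ ℚ.≤ ∑ xs f
  ∑-nonNeg []       0≤f = ℚ.≤-refl
  ∑-nonNeg (x ∷ xs) 0≤f = +-nonNeg (0≤f x) (∑-nonNeg xs 0≤f)

  ∑-const : ∀ (xs : List A) c → ∑ xs (λ _ → c) ≡ ι (length xs) * c
  ∑-const []       c = sym (ℚ.*-zeroˡ c)
  ∑-const (x ∷ xs) c = begin
    c + ∑ xs (λ _ → c)            ≡⟨ cong₂ _+_ (sym (ℚ.*-identityˡ c)) (∑-const xs c) ⟩
    1ℚ * c + ι (length xs) * c    ≡⟨ ℚ.*-distribʳ-+ c 1ℚ (ι (length xs)) ⟨
    (1ℚ + ι (length xs)) * c      ≡⟨ cong (_* c) (/-+ 1 (length xs) 0) ⟩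
    ι (suc (length xs)) * c       ∎
    where
    open ≡-Reasoning

  ∑-++ : ∀ (xs ys : List A) f → ∑ (xs ++ ys) f ≡ ∑ xs f + ∑ ys f
  ∑-++ []       ys f = sym (ℚ.+-identityˡ (∑ ys f))
  ∑-++ (x ∷ xs) ys f = trans (cong (λ s → f x + s) (∑-++ xs ys f)) (sym (ℚ.+-assoc (f x) (∑ xs f) (∑ ys f)))

  ∑-map : ∀ {B : Set} (h : B → A) xs f → ∑ (map h xs) f ≡ ∑ xs (λ x → f (h x))
  ∑-map h []       f = refl
  ∑-map h (x ∷ xs) f = cong (λ s → f (h x) + s) (∑-map h xs f)

  -- The comparison is required only where `P` holds; elsewhere `g` merely adds nonnegative terms.
  -- This is what lets a sum over the pairs of one document be enlarged to all pairs of words, where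
  -- it factors.
  ∑-filter : ∀ {P : A → Set} (P? : Decidable P) xs {f g} →
             (∀ x → P x → f x ℚ.≤ g x) → (∀ x → 0ℚ ℚ.≤ g x) → ∑ (filter P? xs) f ℚ.≤ ∑ xs g
  ∑-filter P? []       f≤g 0≤g = ℚ.≤-refl
  ∑-filter P? (x ∷ xs) {f} {g} f≤g 0≤g with P? x
  ... | yes px = ℚ.+-mono-≤ (f≤g x px) (∑-filter P? xs f≤g 0≤g)
  ... | no  _  = ℚ.≤-trans (∑-filter P? xs f≤g 0≤g)
                   (subst (ℚ._≤ g x + ∑ xs g) (ℚ.+-identityˡ (∑ xs g)) (ℚ.+-monoˡ-≤ (∑ xs g) (0≤g x)))

∑-cartesianProduct : ∀ {A B : Set} (xs : List A) (ys : List B) f →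
                     ∑ (cartesianProduct xs ys) f ≡ ∑ xs (λ x → ∑ ys (λ y → f (x , y)))
∑-cartesianProduct []       ys f = refl
∑-cartesianProduct (x ∷ xs) ys f = trans (∑-++ (map (x ,_) ys) (cartesianProduct xs ys) f)
  (cong₂ _+_ (∑-map (x ,_) ys f) (∑-cartesianProduct xs ys f))

-- Indicators, harmonic numbers and the potential.

χ : ∀ {D} → Subset D → Fin D → ℚ
χ t x = if lookup t x then 1ℚ else 0ℚ

0≤χ : ∀ {D} (t : Subset D) x → 0ℚ ℚ.≤ χ t x
0≤χ t x with lookup t x
... | true  = 0≤ι 1
... | false = ℚ.≤-refl

∑χ : ∀ {D} (t : Subset D) → ∑ (allFin D) (χ t) ≡ ι ∣ t ∣
∑χ []      = refl
∑χ (b ∷ t) = trans (cong (λ s → χ (b ∷ t) Fin.zero + s) tail) (head b)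
  where
  tail : ∑ (tabulate Fin.suc) (χ (b ∷ t)) ≡ ι ∣ t ∣
  tail = trans (cong (λ xs → ∑ xs (χ (b ∷ t))) (sym (map-tabulate (λ x → x) Fin.suc)))
           (trans (∑-map Fin.suc (allFin _) (χ (b ∷ t))) (∑χ t))
  head : ∀ b → χ (b ∷ t) Fin.zero + ι ∣ t ∣ ≡ ι ∣ b ∷ t ∣
  head true  = /-+ 1 ∣ t ∣ 0
  head false = ℚ.+-identityˡ (ι ∣ t ∣)

harmonic : ℕ → ℚ
harmonic n = sumℚ n (λ i → + 1 / suc i)

harmonic-mono : ∀ {m n} → m ≤ n → harmonic m ℚ.≤ harmonic n
harmonic-mono m≤n = go (ℕ.≤⇒≤′ m≤n)
  where
  go : ∀ {m n} → m ℕ.≤′ n → harmonic m ℚ.≤ harmonic n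
  go (ℕ.≤′-reflexive refl) = ℚ.≤-refl
  go (ℕ.≤′-step {n} m≤n) = ≤-+ʳ (ℚ.<⇒≤ (unit-pos n)) (go m≤n)

unitFraction : ℕ → ℚ
-- The default 0 keeps `increment` defined and nonnegative at words that have not occurred yet.
unitFraction zero    = 0ℚ
unitFraction (suc n) = + 1 / suc n

0≤unitFraction : ∀ n → 0ℚ ℚ.≤ unitFraction n
0≤unitFraction zero    = ℚ.≤-refl
0≤unitFraction (suc n) = ℚ.<⇒≤ (unit-pos n)

module _ {D} (t : Subset D) (c : Vec ℕ D) where

  lookup-count : ∀ x → lookup (count t c) x ≡ (if lookup t x then suc (lookup c x) else lookup c x)
  lookup-count x = lookup-zipWith (λ x∈t c → if x∈t then suc c else c) x t c

  lookup-count-≤ : ∀ x → lookup (count t c) x ≤ suc (lookup c x)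
  lookup-count-≤ x rewrite lookup-count x with lookup t x
  ... | true  = ℕ.≤-refl
  ... | false = ℕ.n≤1+n _

  increment : Fin D → ℚ
  increment x = χ t x * unitFraction (lookup (count t c) x)

  0≤increment : ∀ x → 0ℚ ℚ.≤ increment x
  0≤increment x = *-nonNeg (0≤χ t x) (0≤unitFraction (lookup (count t c) x))

  -- If x occurs in `t`, its counter goes from k to k + 1 and the harmonic number gains its last
  -- term 1/(k + 1). That is the reciprocal of the updated counter, the same value that the coins of
  -- this document use.
  harmonic-count : ∀ x → harmonic (lookup (count t c) x) ≡ harmonic (lookup c x) + increment x
  harmonic-count x rewrite lookup-count x with lookup t x
  ... | true  = cong (λ s → harmonic (lookup c x) + s) (sym (ℚ.*-identityˡ _))
  ... | false = sym (trans (cong (λ s → harmonic (lookup c x) + s) (ℚ.*-zeroˡ (unitFraction (lookup c x)))) (ℚ.+-identityʳ _))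

potential : ∀ {D} → Vec ℕ D → ℚ
potential {D} c = ∑ (allFin D) (λ x → harmonic (lookup c x))

potential-count : ∀ {D} (t : Subset D) c → potential (count t c) ≡ potential c + ∑ (allFin D) (increment t c)
potential-count {D} t c = trans (∑-cong (allFin D) (harmonic-count t c)) (∑-+ (allFin D) (λ x → harmonic (lookup c x)) (increment t c))

potential-≤ : ∀ {D} (c : Vec ℕ D) M → (∀ x → lookup c x ≤ M) → potential c ℚ.≤ ι D * harmonic M
potential-≤ {D} c M c≤M = subst (potential c ℚ.≤_)
  (trans (∑-const (allFin D) (harmonic M)) (cong (λ n → ι n * harmonic M) (length-tabulate {n = D} (λ x → x))))
  (∑-mono (allFin D) (λ x → harmonic-mono (c≤M x)))

-- Growth of the hash map.

-- The worst case is a fresh key, which costs one unit for itself and one for the stored number; an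
-- existing key costs only the latter.
size-insert : ∀ {D} (k : Key D) v H → size (insert k v H) ≤ 2 ℕ.+ size H
size-insert k v [] = ℕ.≤-refl
size-insert k v ((k′ , bag) ∷ H) with ≡-dec _≟ᶠ_ _≟ᶠ_ k k′
... | yes _ = ℕ.n≤1+n _
... | no  _ = ℕ.≤-trans (ℕ.+-monoʳ-≤ (suc (length bag)) (size-insert k v H))
  (ℕ.≤-reflexive (solve 2 (λ l s → (con 1 :+ l) :+ (con 2 :+ s) := con 2 :+ ((con 1 :+ l) :+ s)) refl (length bag) (size H)))
  where
  open ℕ-Solver.+-*-Solver

-- Harmonic numbers and logarithms at every index.

sumℚ-nonNeg : ∀ l {f} → (∀ i → 0ℚ ℚ.≤ f i) → 0ℚ ℚ.≤ sumℚ l f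
sumℚ-nonNeg zero    0≤f = ℚ.≤-refl
sumℚ-nonNeg (suc l) 0≤f = +-nonNeg (sumℚ-nonNeg l 0≤f) (0≤f l)

log-seq-nonNeg : ∀ D n → 0ℚ ℚ.≤ log-seq D n
log-seq-nonNeg D n = sumℚ-nonNeg (ℕ.pred D ℕ.* suc n) (λ i → ℚ.<⇒≤ (unit-pos (suc n ℕ.+ i)))

-- Without its first term the harmonic number is the right Riemann sum of mesh 1 for ∫ dt/t, that is
-- `log-seq` at index 0. Since 1/t decreases, refining the mesh only increases a right sum.
harmonic≤1+log : ∀ k n → harmonic (suc k) ℚ.≤ 1ℚ + log-seq (suc k) n
harmonic≤1+log k n = begin
  harmonic (suc k)                                ≡⟨ cong harmonic (ℕ.+-comm 1 k) ⟩
  harmonic (k ℕ.+ 1)                              ≡⟨ sumℚ-++ 1 k (λ i → + 1 / suc i) ⟩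
  1ℚ + sumℚ k (λ i → + 1 / suc (suc i))           ≡⟨ cong (λ l → 1ℚ + sumℚ l (λ i → + 1 / suc (suc i))) (ℕ.*-identityʳ k) ⟨
  1ℚ + log-seq (suc k) 0                          ≤⟨ ℚ.+-monoʳ-≤ 1ℚ (refine-lower (suc k) 0 n) ⟩
  1ℚ + log-seq (suc k) (n ℕ.+ 0)                  ≡⟨ cong (λ i → 1ℚ + log-seq (suc k) i) (ℕ.+-identityʳ n) ⟩
  1ℚ + log-seq (suc k) n                          ∎
  where
  open ℚ.≤-Reasoning

-- 1 + ½ is `harmonic 2`, so subtracting 1 from `harmonic≤1+log` leaves at least ½.
½≤log : ∀ {N} n → 2 ≤ N → ½ ℚ.≤ log-seq N n
½≤log {suc k} n 2≤N = subst₂ ℚ._≤_ refl (solve 1 (λ l → con 1ℚ :+ l :- con 1ℚ := l) refl (log-seq (suc k) n))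
  (ℚ.+-monoˡ-≤ (- 1ℚ) (ℚ.≤-trans (harmonic-mono 2≤N) (harmonic≤1+log k n)))
  where
  open +-*-Solver

½≤1/log2 : ∀ n → ½ ℚ.≤ inv (log-seq 2 n)
½≤1/log2 n = ≤inv (ℚ.<-≤-trans 0<½ (½≤log {2} n ℕ.≤-refl))
  -- Index 0 gives the approximation ½ of log 2, and refinement adds at most 1, so every
  -- approximation is at most 3/2; then ½ · 3/2 = 3/4 ≤ 1.
  (ℚ.≤-trans (*-monoˡ (ℚ.<⇒≤ 0<½) (subst (λ i → log-seq 2 i ℚ.≤ ½ + 1ℚ) (ℕ.+-identityʳ n) (refine-upper 2 0 n)))
             (/-≤ 3 3 1 0 (ℕ.s≤s (ℕ.s≤s (ℕ.s≤s ℕ.z≤n)))))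

-- Expected memory at a fixed index.

-- Heads raises the bound by 2 and has weight q, so the average rises by 2q. The range of q makes
-- both weights nonnegative, as monotonicity requires.
flip-bound : ∀ {q u v x} → 0ℚ ℚ.≤ q → q ℚ.≤ 1ℚ → u ℚ.≤ ι 2 + x → v ℚ.≤ x → q * u + (1ℚ - q) * v ℚ.≤ x + ι 2 * q
flip-bound {q} {u} {v} {x} 0≤q q≤1 u≤ v≤ = ℚ.≤-trans
  (ℚ.+-mono-≤ (*-monoˡ 0≤q u≤) (*-monoˡ (subst (ℚ._≤ 1ℚ - q) (ℚ.+-inverseʳ q) (ℚ.+-monoˡ-≤ (- q) q≤1)) v≤))
  (ℚ.≤-reflexive (solve 2 (λ q x → q :* (con (ι 2) :+ x) :+ (con 1ℚ :- q) :* x := x :+ con (ι 2) :* q) refl q x))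
  where
  open +-*-Solver

module _ (D : ℕ) (ε : ℝ) (0<ε : 0ᴿ <ᴿ ε) (n : ℕ) (0<εₙ : 0ℚ < seq ε n) where

  open Streaming D ε 0<ε

  rate : ℚ
  rate = seq p n * inv (seq ε n)

  0≤rate : 0ℚ ℚ.≤ rate
  0≤rate = *-nonNeg (*-nonNeg (0≤ι 2) (log-seq-nonNeg D n)) (ℚ.<⇒≤ (inv-pos 0<εₙ))

  0≤coin : ∀ c → 0ℚ ℚ.≤ seq (coin c) n
  0≤coin zero    = 0≤ι 1
  0≤coin (suc c) = ℚ.⊓-glb (0≤ι 1) (*-nonNeg 0≤rate (ℚ.<⇒≤ (inv-pos (√-seq-pos c n))))

  coin≤1 : ∀ c → seq (coin c) n ℚ.≤ 1ℚ
  coin≤1 zero    = ℚ.≤-refl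
  coin≤1 (suc c) = ℚ.p⊓q≤p 1ℚ (rate * inv (√-seq (suc c) n))

  coin≤ : ∀ a b → seq (coin (suc a ℕ.* suc b)) n ℚ.≤ rate * (+ 1 / suc a + + 1 / suc b)
  coin≤ a b = ℚ.≤-trans (ℚ.p⊓q≤q 1ℚ (rate * inv (√-seq (suc a ℕ.* suc b) n))) (*-monoˡ 0≤rate (1/√≤ a b n))

  cost : Vec ℕ D → List (Key D) → ℚ
  cost # ps = ∑ ps (λ (x , y) → seq (coin (lookup # x ℕ.* lookup # y)) n)

  -- Induction on the pairs, each coin adding twice its probability by `flip-bound`. The
  -- probabilities depend on the counters alone and not on earlier flips, so `cost` is a fixed
  -- number. The two binds are nested as `arrive` and `process` nest them, so the lemma applies
  -- without an associativity law.
  𝔼-sample : ∀ {A B : Set} # ps H (f : HashMap D → Rand A) (g : A → Rand B) X r →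
             (∀ H′ → seq (𝔼 X (f H′ >>= g)) n ℚ.≤ ι (size H′) + r) →
             seq (𝔼 X (sample # ps H >>= f >>= g)) n ℚ.≤ ι (size H) + (r + ι 2 * cost # ps)
  𝔼-sample # [] H f g X r h = subst (seq (𝔼 X (f H >>= g)) n ℚ.≤_)
    (solve 2 (λ s r → s :+ r := s :+ (r :+ con (ι 2) :* con 0ℚ)) refl (ι (size H)) r) (h H)
    where
    open +-*-Solver
  𝔼-sample # ((x , y) ∷ ps) H f g X r h = ℚ.≤-trans
    (flip-bound (0≤coin c) (coin≤1 c)
      (ℚ.≤-trans (𝔼-sample # ps (insert (x , y) (coin c) H) f g X r h)
        (ℚ.≤-trans (ℚ.+-monoˡ-≤ R grow) (ℚ.≤-reflexive (ℚ.+-assoc (ι 2) (ι (size H)) R))))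
      (𝔼-sample # ps H f g X r h))
    (ℚ.≤-reflexive (solve 4 (λ s r q k → s :+ (r :+ con (ι 2) :* k) :+ con (ι 2) :* q := s :+ (r :+ con (ι 2) :* (q :+ k)))
      refl (ι (size H)) r (seq (coin c) n) (cost # ps)))
    where
    open +-*-Solver
    c = lookup # x ℕ.* lookup # y
    R = r + ι 2 * cost # ps
    grow : ι (size (insert (x , y) (coin c) H)) ℚ.≤ ι 2 + ι (size H)
    grow = subst (ι (size (insert (x , y) (coin c) H)) ℚ.≤_) (sym (/-+ 2 (size H) 0))
      (ι-mono {_} {2 ℕ.+ size H} (size-insert (x , y) (coin c) H))

  -- Expected growth caused by one document.

  module _ (t : Subset D) (c : Vec ℕ D) where

    private
      # = count t c
      v = increment t c
      V = ∑ (allFin D) v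
      T = ∑ (allFin D) (χ t)

    -- For two words of the document this is `rate` times 1/#(x) + 1/#(y). The indicators turn each
    -- summand into a function of x times a function of y, so that the double sum over all words
    -- splits into products of single sums.
    pairBound : Key D → ℚ
    pairBound (x , y) = rate * (v x * χ t y + χ t x * v y)

    0≤pairBound : ∀ k → 0ℚ ℚ.≤ pairBound k
    0≤pairBound (x , y) = *-nonNeg 0≤rate (+-nonNeg (*-nonNeg (0≤increment t c x) (0≤χ t y)) (*-nonNeg (0≤χ t x) (0≤increment t c y)))

    coin≤pairBound : ∀ x y → lookup t x ≡ true → lookup t y ≡ true →
                     seq (coin (lookup # x ℕ.* lookup # y)) n ℚ.≤ pairBound (x , y)
    -- Both words occur, so both updated counters become successors, as `coin≤` demands, and every
    -- indicator becomes 1.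
    coin≤pairBound x y x∈t y∈t rewrite lookup-count t c x | lookup-count t c y | x∈t | y∈t =
      ℚ.≤-trans (coin≤ (lookup c x) (lookup c y)) (ℚ.≤-reflexive
        (solve 3 (λ r a b → r :* (a :+ b) := r :* (con 1ℚ :* a :* con 1ℚ :+ con 1ℚ :* (con 1ℚ :* b)))
          refl rate (+ 1 / suc (lookup c x)) (+ 1 / suc (lookup c y))))
      where
      open +-*-Solver

    ∑pairBound : ∑ (cartesianProduct (allFin D) (allFin D)) pairBound ≡ rate * (ι 2 * T * V)
    ∑pairBound = begin
      ∑ (cartesianProduct (allFin D) (allFin D)) pairBound
        ≡⟨ ∑-cartesianProduct (allFin D) (allFin D) pairBound ⟩
      ∑ (allFin D) (λ x → ∑ (allFin D) (λ y → rate * (v x * χ t y + χ t x * v y)))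
        ≡⟨ ∑-cong (allFin D) (λ x → trans (∑-*ˡ (allFin D) rate _) (cong (rate *_)
             (trans (∑-+ (allFin D) (λ y → v x * χ t y) (λ y → χ t x * v y))
                    (cong₂ _+_ (trans (∑-*ˡ (allFin D) (v x) (χ t)) (ℚ.*-comm (v x) T))
                               (trans (∑-*ˡ (allFin D) (χ t x) v) (ℚ.*-comm (χ t x) V)))))) ⟩
      ∑ (allFin D) (λ x → rate * (T * v x + V * χ t x))
        ≡⟨ trans (∑-*ˡ (allFin D) rate _) (cong (rate *_)
             (trans (∑-+ (allFin D) (λ x → T * v x) (λ x → V * χ t x))
                    (cong₂ _+_ (∑-*ˡ (allFin D) T v) (∑-*ˡ (allFin D) V (χ t))))) ⟩
      rate * (T * V + V * T)
        ≡⟨ solve 3 (λ r T V → r :* (T :* V :+ V :* T) := r :* (con (ι 2) :* T :* V)) refl rate T V ⟩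
      rate * (ι 2 * T * V) ∎
      where
      open +-*-Solver
      open ≡-Reasoning

    -- The sum is enlarged to all ordered pairs of words, where it equals `rate * (ι 2 * T * V)`;
    -- here `T` is the number of words in the document.
    cost-pairs : ∀ {L} → ∣ t ∣ ≤ L → cost # (pairs t) ℚ.≤ rate * (ι 2 * ι L * V)
    cost-pairs {L} t≤L = begin
      cost # (pairs t)
        ≤⟨ ∑-filter _ (cartesianProduct (allFin D) (allFin D))
             (λ (x , y) (_ , x∈t , y∈t) → coin≤pairBound x y ([]=⇒lookup x∈t) ([]=⇒lookup y∈t)) 0≤pairBound ⟩
      ∑ (cartesianProduct (allFin D) (allFin D)) pairBound
        ≡⟨ ∑pairBound ⟩
      rate * (ι 2 * T * V)
        ≤⟨ *-monoˡ 0≤rate (ℚ.*-monoʳ-≤-nonNeg V {{ℚ.nonNegative (∑-nonNeg (allFin D) (0≤increment t c))}}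
             (*-monoˡ (0≤ι 2) (subst (ℚ._≤ ι L) (sym (∑χ t)) (ι-mono {∣ t ∣} {L} t≤L)))) ⟩
      rate * (ι 2 * ι L * V) ∎
      where
      open ℚ.≤-Reasoning

  -- Amortisation over the stream.

  module _ (L M : ℕ) where

    private
      -- The 4 is 2 units of memory per successful coin times the 2 symmetric terms of the pair sum.
      K = rate * (ι 4 * ι L)

    0≤K : 0ℚ ℚ.≤ K
    0≤K = *-nonNeg 0≤rate (*-nonNeg (0≤ι 4) (0≤ι L))

    -- What may still be spent: `ι D` for the counters, and `K` for each unit by which the potential
    -- lies below its ceiling D (1 + 1/2 + ⋯ + 1/M).
    budget : Vec ℕ D → ℚ
    budget c = ι D + K * (ι D * harmonic M - potential c)

    -- The document raises the potential by `V`, which lowers the budget by `K * V`; this is exactly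
    -- the bound that `cost-pairs` gives for twice the cost.
    budget-count : ∀ t c → ∣ t ∣ ≤ L → budget (count t c) + ι 2 * cost (count t c) (pairs t) ℚ.≤ budget c
    budget-count t c t≤L = begin
      budget (count t c) + ι 2 * cost (count t c) (pairs t)
        ≤⟨ ℚ.+-monoʳ-≤ (budget (count t c)) (*-monoˡ (0≤ι 2) (cost-pairs t c t≤L)) ⟩
      budget (count t c) + ι 2 * (rate * (ι 2 * ι L * V))
        ≡⟨ cong (λ Φ → ι D + K * (ι D * harmonic M - Φ) + ι 2 * (rate * (ι 2 * ι L * V))) (potential-count t c) ⟩
      ι D + K * (ι D * harmonic M - (potential c + V)) + ι 2 * (rate * (ι 2 * ι L * V))
        ≡⟨ solve 6 (λ d r l m Φ V → d :+ r :* (con (ι 4) :* l) :* (m :- (Φ :+ V)) :+ con (ι 2) :* (r :* (con (ι 2) :* l :* V))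
                                    := d :+ r :* (con (ι 4) :* l) :* (m :- Φ))
             refl (ι D) rate (ι L) (ι D * harmonic M) (potential c) V ⟩
      budget c ∎
      where
      open +-*-Solver
      open ℚ.≤-Reasoning
      V = ∑ (allFin D) (increment t c)

    -- The hypothesis on the counters reserves one increment for each of the `N` documents still to
    -- come. At the end of the stream it leaves every counter at most `M`, so the unspent potential
    -- is nonnegative.
    𝔼-process : ∀ {N} (ts : Vec (Subset D) N) s → All (λ t → ∣ t ∣ ≤ L) ts →
                (∀ x → lookup (counters s) x ℕ.+ N ≤ M) →
                seq (𝔼 (λ s → fromℕ (memory s)) (process ts s)) n ℚ.≤ ι (size (H s)) + budget (counters s)
    𝔼-process [] s [] c≤M = begin
      ι (D ℕ.+ size (H s))                     ≡⟨ cong ι (ℕ.+-comm D (size (H s))) ⟩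
      ι (size (H s) ℕ.+ D)                     ≡⟨ /-+ (size (H s)) D 0 ⟨
      ι (size (H s)) + ι D                     ≤⟨ ℚ.+-monoʳ-≤ (ι (size (H s))) (≤-+ʳ (*-nonNeg 0≤K 0≤slack) ℚ.≤-refl) ⟩
      ι (size (H s)) + budget (counters s)     ∎
      where
      open ℚ.≤-Reasoning
      0≤slack : 0ℚ ℚ.≤ ι D * harmonic M - potential (counters s)
      0≤slack = subst (ℚ._≤ ι D * harmonic M - potential (counters s)) (ℚ.+-inverseʳ (potential (counters s)))
        (ℚ.+-monoˡ-≤ (- potential (counters s)) (potential-≤ (counters s) M
          (λ x → subst (_≤ M) (ℕ.+-identityʳ _) (c≤M x))))
    𝔼-process {suc N} (t ∷ ts) s (t≤L ∷ ts≤L) c≤M = ℚ.≤-trans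
      (𝔼-sample # (pairs t) (H s) _ (process ts) _ (budget #)
        (λ H′ → 𝔼-process ts (record { counters = # ; H = H′ }) ts≤L
          -- A counter rises by at most one while one document fewer remains.
          (λ x → ℕ.≤-trans (ℕ.+-monoˡ-≤ N (lookup-count-≤ t (counters s) x))
                   (ℕ.≤-trans (ℕ.≤-reflexive (sym (ℕ.+-suc (lookup (counters s) x) N))) (c≤M x)))))
      (ℚ.+-monoʳ-≤ (ι (size (H s))) (budget-count t (counters s) t≤L))
      where
      # = count t (counters s)

    expectedMemory-≤ : (ts : Vec (Subset D) M) → All (λ t → ∣ t ∣ ≤ L) ts →
                       seq (expectedMemory ts) n ℚ.≤ ι D + K * (ι D * harmonic M)
    expectedMemory-≤ ts ts≤L = begin
      seq (expectedMemory ts) n        ≤⟨ 𝔼-process ts empty ts≤L (λ x → ℕ.≤-reflexive (cong (ℕ._+ M) (lookup-replicate x 0))) ⟩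
      0ℚ + budget c₀                   ≡⟨ ℚ.+-identityˡ (budget c₀) ⟩
      ι D + K * (ι D * harmonic M - potential c₀)
        ≤⟨ ℚ.+-monoʳ-≤ (ι D) (*-monoˡ 0≤K (subst (ι D * harmonic M - potential c₀ ℚ.≤_) (ℚ.+-identityʳ _)
             (ℚ.+-monoʳ-≤ (ι D * harmonic M) (ℚ.neg-antimono-≤ 0≤potential)))) ⟩
      ι D + K * (ι D * harmonic M)     ∎
      where
      open ℚ.≤-Reasoning
      c₀ : Vec ℕ D
      c₀ = counters (empty {D})
      0≤potential : 0ℚ ℚ.≤ potential c₀
      0≤potential = ∑-nonNeg (allFin D) (λ x → harmonic-mono {0} {lookup c₀ x} ℕ.z≤n)

-- Constants and the final estimate.

-- The letters stand for D, L, lg N, the N-th harmonic number, log D and 1/ε at one index. The lower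
-- bounds multiply to 1 · ¼ · ½ · ½ = 1/16, so the counters cost at most 16 times the product; the
-- hash map costs 2 · 4 · 6 = 48 times it, and 16 + 48 = 64.
arithmetic : ∀ {d l g h λD i} → 0ℚ ℚ.≤ d → 1ℚ ℚ.≤ l → + 1 / 4 ℚ.≤ g → ½ ℚ.≤ λD → ½ ℚ.≤ i → h ℚ.≤ ι 6 * g →
             d + ι 2 * λD * i * (ι 4 * l) * (d * h) ℚ.≤ ι 64 * (d * l * g * λD * i)
arithmetic {d} {l} {g} {h} {λD} {i} 0≤d 1≤l ¼≤g ½≤λD ½≤i h≤6g = begin
  d + ι 2 * λD * i * (ι 4 * l) * (d * h)
    ≤⟨ ℚ.+-mono-≤ d≤ (*-monoˡ (*-nonNeg (*-nonNeg (*-nonNeg (0≤ι 2) 0≤λD) 0≤i) (*-nonNeg (0≤ι 4) 0≤l)) (*-monoˡ 0≤d h≤6g)) ⟩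
  ι 16 * (d * l * g * λD * i) + ι 2 * λD * i * (ι 4 * l) * (d * (ι 6 * g))
    ≡⟨ solve 5 (λ d l g λD i → con (ι 16) :* (d :* l :* g :* λD :* i) :+ con (ι 2) :* λD :* i :* (con (ι 4) :* l) :* (d :* (con (ι 6) :* g))
                               := con (ι 64) :* (d :* l :* g :* λD :* i)) refl d l g λD i ⟩
  ι 64 * (d * l * g * λD * i) ∎
  where
  open +-*-Solver
  open ℚ.≤-Reasoning
  0≤½ = ℚ.<⇒≤ 0<½
  0≤λD = ℚ.≤-trans 0≤½ ½≤λD
  0≤i = ℚ.≤-trans 0≤½ ½≤i
  0≤l = ℚ.≤-trans (0≤ι 1) 1≤l
  0≤¼ = ℚ.<⇒≤ (unit-pos 3)
  0≤g = ℚ.≤-trans 0≤¼ ¼≤g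
  0≤d1 = *-nonNeg 0≤d (0≤ι 1)
  0≤d1¼ = *-nonNeg 0≤d1 0≤¼
  d≤ : d ℚ.≤ ι 16 * (d * l * g * λD * i)
  d≤ = subst (ℚ._≤ ι 16 * (d * l * g * λD * i))
    (solve 1 (λ d → con (ι 16) :* (d :* con 1ℚ :* con (+ 1 / 4) :* con ½ :* con ½) := d) refl d)
    (*-monoˡ (0≤ι 16) (*-mono (*-nonNeg 0≤d1¼ 0≤½) 0≤i
      (*-mono 0≤d1¼ 0≤λD (*-mono 0≤d1 0≤g (*-monoˡ 0≤d 1≤l) ¼≤g) ½≤λD) ½≤i))

lg-lower : ∀ N n → ½ * log-seq N n ℚ.≤ log-seq N n * inv (log-seq 2 n)
lg-lower N n = subst (ℚ._≤ log-seq N n * inv (log-seq 2 n)) (ℚ.*-comm (log-seq N n) ½)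
  (*-monoˡ (log-seq-nonNeg N n) (½≤1/log2 n))

-- Since log N ≥ ½, the extra 1 is at most 2 log N, giving 3 log N in total; and log N ≤ 2 lg N
-- because 1/log 2 ≥ ½.
harmonic≤6lg : ∀ {N} n → 2 ≤ N → harmonic N ℚ.≤ ι 6 * (log-seq N n * inv (log-seq 2 n))
harmonic≤6lg {N@(suc k)} n 2≤N = begin
  harmonic N                        ≤⟨ harmonic≤1+log k n ⟩
  1ℚ + l                            ≤⟨ ℚ.+-monoˡ-≤ l (*-monoˡ (0≤ι 2) (½≤log {N} n 2≤N)) ⟩
  ι 2 * l + l                       ≡⟨ solve 1 (λ l → con (ι 2) :* l :+ l := con (ι 6) :* (con ½ :* l)) refl l ⟩
  ι 6 * (½ * l)                     ≤⟨ *-monoˡ (0≤ι 6) (lg-lower N n) ⟩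
  ι 6 * (l * inv (log-seq 2 n))     ∎
  where
  open +-*-Solver
  open ℚ.≤-Reasoning
  l = log-seq N n

theorem7 : Σ[ C ∈ ℝ ]
    ((D L N : ℕ) → 2 ≤ D → 1 ≤ L → 2 ≤ N →
    (ε : ℝ) → (0<ε : 0ᴿ <ᴿ ε) → ε ≤ᴿ 1ᴿ →
    (ts : Vec (Subset D) N) → All (λ t → ∣ t ∣ ≤ L) ts →
    Streaming.expectedMemory D ε 0<ε ts
    ≤ᴿ C *ᴿ (fromℕ D *ᴿ fromℕ L *ᴿ lg N *ᴿ log D *ᴿ recip ε 0<ε))
theorem7 = fromℕ 64 , λ D L N 2≤D 1≤L 2≤N ε 0<ε@(c , 0<c , N₁ , c≤ε) ε≤1 ts ts≤L δ 0<δ →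
  -- Slack 1 in ε ≤ 1 gives εₙ ≤ 2 from some index on, hence 1/εₙ ≥ ½; `N₁` is where εₙ is bounded
  -- below by c > 0.
  let N₂ , ε≤2 = ε≤1 1ℚ (ℚ.positive⁻¹ 1ℚ)
  in N₁ ℕ.⊔ N₂ , λ n N≤n →
    let 0<εₙ = ℚ.<-≤-trans 0<c (subst (ℚ._≤ seq ε n) (ℚ.+-identityˡ c) (c≤ε n (ℕ.m⊔n≤o⇒m≤o N₁ N₂ N≤n)))
        ½≤1/ε = ≤inv 0<εₙ (*-monoˡ (ℚ.<⇒≤ 0<½) (ε≤2 n (ℕ.m⊔n≤o⇒n≤o N₁ N₂ N≤n)))
        -- ¼ is ½ · ½, from log N ≥ ½ and 1/log 2 ≥ ½.
        ¼≤lg = ℚ.≤-trans (*-monoˡ (ℚ.<⇒≤ 0<½) (½≤log {N} n 2≤N)) (lg-lower N n)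
    in ≤-+ʳ (ℚ.<⇒≤ 0<δ) (ℚ.≤-trans (expectedMemory-≤ D ε 0<ε n 0<εₙ L N ts ts≤L)
         (arithmetic (0≤ι D) (ι-mono {1} {L} 1≤L) ¼≤lg (½≤log {D} n 2≤D) ½≤1/ε (harmonic≤6lg {N} n 2≤N)))
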